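{- Every oriented graph without transmitters has at least three weak kings.
   Context: An oriented graph is a digraph with no loops and no pair of symmetric arcs. A transmitter is a vertex of indegree $0$. For vertices $u,v$ write $u(1\text{ - }0)v$ if there is an arc from $u$ to $v$, and $u(0\text{ - }0)v$ if there is no arc between $u$ and $v$. A vertex $v$ is weakly reachable within two steps from $u$ if $u(1\text{ - }0)v$, or $u(0\text{ - }0)v$, or for some vertex $w$ one has $u(1\text{ - }0)w(1\text{ - }0)v$, or $u(1\text{ - }0)w(0\text{ - }0)v$, or $u(0\text{ - }0)w(1\text{ - }0)v$. A vertex $u$ of an oriented graph $D$ is a weak king if every other vertex of $D$ is weakly reachable within two steps from $u$. -}

module Defs where

open import Data.Fin using (Fin)
open import Data.List using (allFin; filter; length)
open import Data.Nat using (ℕ)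
open import Data.Product using (_×_; ∃-syntax)
open import Data.Sum using (_⊎_)
open import Level using (0ℓ)
open import Relation.Binary using (Rel; Irreflexive; Asymmetric; Decidable)
open import Relation.Binary.PropositionalEquality using (_≡_; _≢_)
open import Relation.Nullary using (¬_)

-- Graphs are finite, with vertex set Fin n. Decidability of Arc expresses
-- constructively that the arc set is a subset of the finite set of vertex pairs.
record OrientedGraph (n : ℕ) : Set₁ where
  field
    Arc   : Rel (Fin n) 0ℓ
    arc?  : Decidable Arc
    irrefl : Irreflexive _≡_ Arc
    asym   : Asymmetric Arc

module _ {n : ℕ} (D : OrientedGraph n) where
  open OrientedGraph D

  indegree : Fin n → ℕ
  indegree v = length (filter (λ u → arc? u v) (allFin n))

  Transmitter : Fin n → Set
  Transmitter v = indegree v ≡ 0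

  -- u (0-0) v
  NoArcBetween : Rel (Fin n) 0ℓ
  NoArcBetween u v = ¬ Arc u v × ¬ Arc v u

  -- The intermediate vertex w may equal u or v: by irreflexivity such a path
  -- only repeats one of the first two alternatives.
  WeaklyReachable : Rel (Fin n) 0ℓ
  WeaklyReachable u v =
      Arc u v
    ⊎ NoArcBetween u v
    ⊎ (∃[ w ] (Arc u w × Arc w v))
    ⊎ (∃[ w ] (Arc u w × NoArcBetween w v))
    ⊎ (∃[ w ] (NoArcBetween u w × Arc w v))

  WeakKing : Fin n → Set
  WeakKing u = ∀ v → v ≢ u → WeaklyReachable u v

{-# OPTIONS --safe #-}

-- v is not weakly reachable from u exactly when v covers u: v beats u, v beats
-- everything u beats, and u is beaten by everything that beats v. Covering is a
-- strict partial order whose maximal elements are the weak kings, and a vertex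
-- covering an in-neighbour of x is again an in-neighbour of x. Climbing the order
-- from an in-neighbour of x therefore ends at a weak king that beats x. Three
-- weak kings with c → b → a are distinct, as arcs are asymmetric.

module Submission where

open import Data.Empty using (⊥-elim)
open import Data.Fin using (Fin; zero)
open import Data.Fin.Induction using (spo-wellFounded)
open import Data.Fin.Properties using (any?)
open import Data.List using (allFin; length)
open import Data.List.Properties using (filter-none)
open import Data.List.Relation.Unary.All using (universal)
open import Data.Nat using (ℕ; _≤_; s≤s)
open import Data.Product using (_×_; ∃-syntax; _,_)
open import Data.Sum using (inj₁; inj₂)
open import Function using (_∘_)
open import Induction.WellFounded using (Acc; acc)
open import Relation.Binary using (Decidable; IsStrictPartialOrder)
open import Relation.Binary.PropositionalEquality using (_≡_; _≢_; refl; cong; isEquivalence; resp₂)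
open import Relation.Nullary using (¬_; yes; no; ¬?; _×-dec_; _⊎-dec_)
open import Relation.Nullary.Decidable using (decidable-stable)
open import Defs

module _ {n : ℕ} (D : OrientedGraph n) where
  open OrientedGraph D

  noArcBetween? : Decidable (NoArcBetween D)
  noArcBetween? u v = ¬? (arc? u v) ×-dec ¬? (arc? v u)

  weaklyReachable? : Decidable (WeaklyReachable D)
  weaklyReachable? u v =
    arc? u v
    ⊎-dec noArcBetween? u v
    ⊎-dec any? (λ w → arc? u w ×-dec arc? w v)
    ⊎-dec any? (λ w → arc? u w ×-dec noArcBetween? w v)
    ⊎-dec any? (λ w → noArcBetween? u w ×-dec arc? w v)

  record Covers (v u : Fin n) : Set where
    field
      beats : Arc v u
      out-⊆ : ∀ {w} → Arc u w → Arc v w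
      in-⊆  : ∀ {w} → Arc w v → Arc w u

  open Covers

  -- Failure of any field would make `v` weakly reachable. If `u` beats `w` but `v` does not, the
  -- route through `w` works whether `w` beats `v` or has no arc with it; if `w` beats `v` but not
  -- `u`, it works whether or not `u` beats `w`.
  ¬weaklyReachable⇒covers : ∀ {v u} → ¬ WeaklyReachable D u v → Covers v u
  ¬weaklyReachable⇒covers {v} {u} ¬r = record
    { beats = beats′ ; out-⊆ = out-⊆′ ; in-⊆ = in-⊆′ }
    where
    beats′ : Arc v u
    beats′ with arc? v u
    ... | yes v→u = v→u
    ... | no  v↛u = ⊥-elim (¬r (inj₂ (inj₁ (¬r ∘ inj₁ , v↛u))))

    out-⊆′ : ∀ {w} → Arc u w → Arc v w
    out-⊆′ {w} u→w with arc? v w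
    ... | yes v→w = v→w
    ... | no  v↛w = ⊥-elim (¬r (inj₂ (inj₂ (inj₂ (inj₁ (w , u→w , w↛v , v↛w))))))
      where
      w↛v : ¬ Arc w v
      w↛v w→v = ¬r (inj₂ (inj₂ (inj₁ (w , u→w , w→v))))

    in-⊆′ : ∀ {w} → Arc w v → Arc w u
    in-⊆′ {w} w→v with arc? w u
    ... | yes w→u = w→u
    ... | no  w↛u = ⊥-elim (¬r (inj₂ (inj₂ (inj₂ (inj₂ (w , (u↛w , w↛u) , w→v))))))
      where
      u↛w : ¬ Arc u w
      u↛w u→w = ¬r (inj₂ (inj₂ (inj₁ (w , u→w , w→v))))

  -- `Covers v u` is read as `v < u`, so well-founded recursion on the finite vertex set passes from
  -- a vertex to one that covers it.
  covers-isStrictPartialOrder : IsStrictPartialOrder _≡_ Covers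
  covers-isStrictPartialOrder = record
    { isEquivalence = isEquivalence
    ; irrefl        = λ u≡v c → irrefl u≡v (beats c)
    ; trans         = λ c d → record
      { beats = out-⊆ c (beats d)
      ; out-⊆ = out-⊆ c ∘ out-⊆ d
      ; in-⊆  = in-⊆ d ∘ in-⊆ c
      }
    ; <-resp-≈      = resp₂ Covers
    }

  inNeighbour⇒weakKing-inNeighbour :
    ∀ {x y} → Arc y x → ∃[ k ] (WeakKing D k × Arc k x)
  inNeighbour⇒weakKing-inNeighbour {x} {y} =
    climb (spo-wellFounded covers-isStrictPartialOrder y)
    where
    climb : ∀ {y} → Acc Covers y → Arc y x → ∃[ k ] (WeakKing D k × Arc k x)
    -- The search need not exclude `y`: having no loop, `y` satisfies `NoArcBetween D y y` and so is
    -- weakly reachable from itself.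
    climb {y} (acc rs) y→x with any? (¬? ∘ weaklyReachable? y)
    ... | no  ¬∃ =
      y , (λ v _ → decidable-stable (weaklyReachable? y v) (λ ¬r → ¬∃ (v , ¬r))) , y→x
    ... | yes (v , ¬r) = climb (rs v-covers-y) (out-⊆ v-covers-y y→x)
      where
      v-covers-y : Covers v y
      v-covers-y = ¬weaklyReachable⇒covers ¬r

  ¬transmitter⇒inNeighbour : ∀ {v} → ¬ Transmitter D v → ∃[ u ] Arc u v
  ¬transmitter⇒inNeighbour {v} ¬t with any? (λ u → arc? u v)
  ... | yes u→v = u→v
  ... | no  ¬∃  = ⊥-elim (¬t (cong length
    (filter-none (λ u → arc? u v) (universal (λ u u→v → ¬∃ (u , u→v)) (allFin n)))))

  ¬transmitter⇒weakKing-inNeighbour :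
    ∀ {v} → ¬ Transmitter D v → ∃[ k ] (WeakKing D k × Arc k v)
  ¬transmitter⇒weakKing-inNeighbour ¬t with ¬transmitter⇒inNeighbour ¬t
  ... | _ , u→v = inNeighbour⇒weakKing-inNeighbour u→v

theorem6 : (n : ℕ) → 1 ≤ n → (D : OrientedGraph n) →
    (∀ v → ¬ Transmitter D v) →
    ∃[ u ] ∃[ v ] ∃[ w ]
    (u ≢ v × u ≢ w × v ≢ w × WeakKing D u × WeakKing D v × WeakKing D w)
theorem6 _ (s≤s _) D ¬t
  -- The vertex `zero` exists because `1 ≤ n`; it provides the first king, and each later king is
  -- taken among the in-neighbours of the previous one.
  with a , king-a , _   ← ¬transmitter⇒weakKing-inNeighbour D (¬t zero)
  with b , king-b , b→a ← ¬transmitter⇒weakKing-inNeighbour D (¬t a)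
  with c , king-c , c→b ← ¬transmitter⇒weakKing-inNeighbour D (¬t b)
  = a , b , c
  , (λ { refl → irrefl refl b→a })
  , (λ { refl → asym b→a c→b })
  , (λ { refl → irrefl refl c→b })
  , king-a , king-b , king-c
  where open OrientedGraph D
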